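{- Let $G$ be a finite simple graph with at least one vertex. If $G$ is uniquely colorable, then $G$ is critically $(\chi(G)-1)$-uniform.
   Context: $[k]=\{1,\dots,k\}$ and $\chi(G)$ is the chromatic number of $G$. A coloring of $G=(V,E)$ with $k$ colors is optimal if $k=\chi(G)$. $G$ is uniquely colorable if it has exactly one optimal proper coloring $c:V\to[\chi(G)]$ up to permutation of the colors. For a proper coloring $c:V\to[\chi(G)]$, a determining set for $(G,c)$ is a set $S\subseteq V$ such that for every proper coloring $c':V\to[\chi(G)]$ of $G$, if $c'|_S=c|_S$ then $c'=c$ on all of $V$. A critical set for $(G,c)$ is a determining set for $(G,c)$ that is minimal under inclusion. A critical set of $G$ is a critical set for $(G,c)$ for some proper coloring $c:V\to[\chi(G)]$. $G$ is critically $k$-uniform if every critical set $S\subseteq V$ of $G$ (for every proper coloring $c:V\to[\chi(G)]$) satisfies $|S|=k$. -}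

module Defs where

open import Data.Fin.Base using (Fin; finToFun; funToFin)
open import Data.Fin.Permutation using (Permutation′; _⟨$⟩ʳ_)
open import Data.Fin.Properties using (_≟_; any?; all?; finToFun-funToFin)
open import Data.Fin.Subset using (Subset; _∈_; _⊆_; ∣_∣)
open import Data.Nat.Base using (ℕ; zero; suc; _≤_; z≤n; s≤s; _^_)
open import Data.Product.Base using (∃; _×_; _,_; proj₁; proj₂)
open import Function.Base using (id; _∘_)
open import Level using (Level; 0ℓ)
open import Relation.Binary.Core using (Rel)
import Relation.Binary.Definitions as B
open import Relation.Binary.PropositionalEquality
  using (_≡_; _≢_; _≗_; sym; trans)
open import Relation.Nullary.Decidable using (Dec; yes; no; map′; ¬?; _→-dec_)
open import Relation.Nullary.Negation using (contradiction)
open import Relation.Unary using (Pred; Decidable)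

private
  variable
    ℓ : Level
    n : ℕ

-- Finite simple graphs with vertex set Fin n.  Adjacency is decidable,
-- which costs nothing classically and lets χ below be computed.

record Graph (n : ℕ) : Set₁ where
  field
    Adj    : Rel (Fin n) 0ℓ
    adj?   : B.Decidable Adj
    symm   : B.Symmetric Adj
    irrefl : B.Irreflexive _≡_ Adj

Coloring : Graph n → ℕ → Set
Coloring {n} G k = Fin n → Fin k

Proper : (G : Graph n) {k : ℕ} → Coloring G k → Set
Proper G c = ∀ u v → Graph.Adj G u v → c u ≢ c v

Colorable : Graph n → ℕ → Set
Colorable G k = ∃ λ (c : Coloring G k) → Proper G c

proper? : (G : Graph n) {k : ℕ} (c : Coloring G k) → Dec (Proper G c)
proper? G c =
  all? λ u → all? λ v → Graph.adj? G u v →-dec ¬? (c u ≟ c v)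

-- Fin (k ^ n) enumerates the functions Fin n → Fin k up to _≗_.

colorable? : (G : Graph n) → Decidable (Colorable G)
colorable? {n} G k = map′
  (λ (i , p) → finToFun i , p)
  (λ (c , p) → funToFin c , λ u v a e →
    p u v a (trans (sym (finToFun-funToFin c u)) (trans e (finToFun-funToFin c v))))
  (any? {n = k ^ n} λ i → proper? G (finToFun i))

n-colorable : (G : Graph n) → Colorable G n
n-colorable G = id , λ _ _ a u≡v → Graph.irrefl G u≡v a

least : {P : Pred ℕ ℓ} → Decidable P → (m : ℕ) → P m →
        ∃ λ k → P k × (∀ {j} → P j → k ≤ j)
least P? zero    p = 0 , p , λ _ → z≤n
least P? (suc m) p with P? 0
... | yes p₀ = 0 , p₀ , λ _ → z≤n
... | no ¬p₀ with least (P? ∘ suc) m p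
...   | k , pk , min = suc k , pk ,
        λ { {zero} p₀ → contradiction p₀ ¬p₀ ; {suc j} pj → s≤s (min pj) }

χ : Graph n → ℕ
χ {n} G = proj₁ (least (colorable? G) n (n-colorable G))

χ-colorable : (G : Graph n) → Colorable G (χ G)
χ-colorable {n} G = proj₁ (proj₂ (least (colorable? G) n (n-colorable G)))

χ-minimal : (G : Graph n) {k : ℕ} → Colorable G k → χ G ≤ k
χ-minimal {n} G = proj₂ (proj₂ (least (colorable? G) n (n-colorable G)))

UniquelyColorable : Graph n → Set
UniquelyColorable G =
  ∃ λ (c : Coloring G (χ G)) → Proper G c ×
    (∀ (c′ : Coloring G (χ G)) → Proper G c′ →
      ∃ λ (π : Permutation′ (χ G)) → c′ ≗ (π ⟨$⟩ʳ_) ∘ c)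

Determining : (G : Graph n) → Coloring G (χ G) → Subset n → Set
Determining G c S =
  ∀ (c′ : Coloring G (χ G)) → Proper G c′ →
    (∀ {v} → v ∈ S → c′ v ≡ c v) → c′ ≗ c

Critical : (G : Graph n) → Coloring G (χ G) → Subset n → Set
Critical {n} G c S =
  Determining G c S × (∀ (T : Subset n) → T ⊆ S → Determining G c T → T ≡ S)

CriticalSet : (G : Graph n) → Subset n → Set
CriticalSet G S = ∃ λ (c : Coloring G (χ G)) → Proper G c × Critical G c S

CriticallyUniform : Graph n → ℕ → Set
CriticallyUniform {n} G k = ∀ (S : Subset n) → CriticalSet G S → ∣ S ∣ ≡ k

{-# OPTIONS --safe #-}

-- Since G is uniquely colorable, any two optimal colorings differ by a
-- permutation of the colors.  A permutation fixing all colors but one is the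
-- identity, so a set meeting at least χ(G) − 1 color classes is determining;
-- conversely a set missing two classes is not, as those two colors can be
-- swapped (both occur, by minimality of χ(G)).  A critical set S therefore
-- contains a transversal of χ(G) − 1 color classes, which is itself
-- determining, hence equal to S.

module Submission where

open import Defs
open import Data.Fin.Base using (Fin; zero; suc; punchIn; punchOut)
open import Data.Fin.Permutation using (Permutation′; _⟨$⟩ʳ_; _⟨$⟩ˡ_; _∘ₚ_; flip; transpose; inverseˡ)
open import Data.Fin.Properties
  using (_≟_; any?; punchInᵢ≢i; punchIn-injective; punchIn-punchOut; punchOut-injective; suc-injective; 0≢1+n)
open import Data.Fin.Subset using (Subset; inside; outside; _∈_; _∉_; _⊆_; ∣_∣; ⁅_⁆; _∪_; ⊥)
open import Data.Fin.Subset.Properties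
  using (_∈?_; ∉⊥; ∣⊥∣≡0; ∪-identityˡ; x∈p∪q⁺; x∈p∪q⁻; x∈⁅x⁆; x∈⁅y⁆⇒x≡y)
open import Data.Nat.Base using (ℕ; zero; suc; _<_; NonZero; _∸_)
open import Data.Nat.Properties using (n<1+n; <⇒≱)
open import Data.Product.Base using (∃; _×_; _,_; proj₁; proj₂)
open import Data.Sum.Base using (inj₁; inj₂)
open import Data.Vec.Base using (_∷_; here; there)
open import Function.Base using (_∘_)
open import Function.Bundles using (Injection)
open import Function.Definitions using (Injective)
open import Function.Properties.Inverse using (↔⇒↣)
open import Relation.Binary.PropositionalEquality
  using (_≡_; _≢_; _≗_; refl; sym; trans; cong; module ≡-Reasoning)
open import Relation.Nullary.Decidable using (Dec; yes; no; _×-dec_; ¬?; decidable-stable; dec-true; dec-false)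
open import Relation.Nullary.Negation using (¬_; contradiction)

private
  variable
    n k m : ℕ

∣⁅x⁆∪p∣≡1+∣p∣ : (x : Fin n) (p : Subset n) → x ∉ p → ∣ ⁅ x ⁆ ∪ p ∣ ≡ suc ∣ p ∣
∣⁅x⁆∪p∣≡1+∣p∣ zero    (inside  ∷ p) x∉p = contradiction here x∉p
∣⁅x⁆∪p∣≡1+∣p∣ zero    (outside ∷ p) x∉p = cong (suc ∘ ∣_∣) (∪-identityˡ p)
∣⁅x⁆∪p∣≡1+∣p∣ (suc x) (inside  ∷ p) x∉p = cong suc (∣⁅x⁆∪p∣≡1+∣p∣ x p (x∉p ∘ there))
∣⁅x⁆∪p∣≡1+∣p∣ (suc x) (outside ∷ p) x∉p = ∣⁅x⁆∪p∣≡1+∣p∣ x p (x∉p ∘ there)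

-- Built by inserting one point at a time, so that for injective `f` each insertion adds exactly one
-- to the size.
image : (Fin m → Fin n) → Subset n
image {zero}  f = ⊥
image {suc m} f = ⁅ f zero ⁆ ∪ image (f ∘ suc)

∈-image⁺ : (f : Fin m → Fin n) (i : Fin m) → f i ∈ image f
∈-image⁺ f zero    = x∈p∪q⁺ (inj₁ (x∈⁅x⁆ _))
∈-image⁺ f (suc i) = x∈p∪q⁺ (inj₂ (∈-image⁺ (f ∘ suc) i))

∈-image⁻ : (f : Fin m → Fin n) {v : Fin n} → v ∈ image f → ∃ λ i → f i ≡ v
∈-image⁻ {zero}  f v∈ = contradiction v∈ ∉⊥
∈-image⁻ {suc m} f v∈ with x∈p∪q⁻ ⁅ f zero ⁆ _ v∈
... | inj₁ v∈₀ = zero , sym (x∈⁅y⁆⇒x≡y _ v∈₀)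
... | inj₂ v∈₁ with ∈-image⁻ (f ∘ suc) v∈₁
...   | i , fi≡v = suc i , fi≡v

∣image∣ : (f : Fin m → Fin n) → Injective _≡_ _≡_ f → ∣ image f ∣ ≡ m
∣image∣ {zero}  {n} f inj = ∣⊥∣≡0 n
∣image∣ {suc m}     f inj = trans
  (∣⁅x⁆∪p∣≡1+∣p∣ (f zero) _ λ f0∈ → let i , e = ∈-image⁻ (f ∘ suc) f0∈ in 0≢1+n (sym (inj e)))
  (cong suc (∣image∣ (f ∘ suc) (suc-injective ∘ inj)))

-- punchIn for a color set whose size is not syntactically a successor.
skip : Fin k → Fin (k ∸ 1) → Fin k
skip {suc _} = punchIn

skip-≢ : (a : Fin k) (j : Fin (k ∸ 1)) → skip a j ≢ a
skip-≢ {suc _} = punchInᵢ≢i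

skip-injective : (a : Fin k) → Injective _≡_ _≡_ (skip a)
skip-injective {suc _} a = punchIn-injective a _ _

skip-surjective : (a b : Fin k) → b ≢ a → ∃ λ j → skip a j ≡ b
skip-surjective {suc _} a b b≢a = punchOut (b≢a ∘ sym) , punchIn-punchOut _

⟨$⟩ʳ-injective : (π : Permutation′ k) → Injective _≡_ _≡_ (π ⟨$⟩ʳ_)
⟨$⟩ʳ-injective π = Injection.injective (↔⇒↣ π)

transpose-left : (a b : Fin k) → transpose a b ⟨$⟩ʳ a ≡ b
transpose-left a b rewrite dec-true (a ≟ a) refl = refl

transpose-fixes : (a b x : Fin k) → x ≢ a → x ≢ b → transpose a b ⟨$⟩ʳ x ≡ x
transpose-fixes a b x x≢a x≢b
  rewrite dec-false (x ≟ a) x≢a | dec-false (x ≟ b) x≢b = refl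

-- If `π` moved `a`, then `π a` would be among the fixed colors, so `π (π a) = π a`, and injectivity
-- would give `π a = a` after all.
fixes-all-but-one : (π : Permutation′ k) (a : Fin k) →
  (∀ x → x ≢ a → π ⟨$⟩ʳ x ≡ x) → ∀ x → π ⟨$⟩ʳ x ≡ x
fixes-all-but-one π a fix x with π ⟨$⟩ʳ x ≟ x
... | yes πx≡x = πx≡x
... | no  πx≢x with x ≟ a
...   | no  x≢a  = fix x x≢a
...   | yes refl = ⟨$⟩ʳ-injective π (fix (π ⟨$⟩ʳ x) πx≢x)

module _ (G : Graph n) where

  proper-permute : (π : Permutation′ k) (c : Coloring G k) →
    Proper G c → Proper G ((π ⟨$⟩ʳ_) ∘ c)
  proper-permute π c p u v a = p u v a ∘ ⟨$⟩ʳ-injective π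

  -- `punchOut` closes the gap at `a` injectively, so adjacent vertices keep distinct colors. The
  -- generic `k` can be split into a successor by matching, whereas `χ G` is not syntactically one.
  missed-color⇒fewer-colors : (c : Coloring G k) → Proper G c → (a : Fin k) →
    (∀ v → a ≢ c v) → ∃ λ j → j < k × Colorable G j
  missed-color⇒fewer-colors {suc m} c p a missed =
    m , n<1+n m , (λ v → punchOut (missed v)) ,
    λ u v adj e → p u v adj (punchOut-injective (missed u) (missed v) e)

  optimal-surjective : (c : Coloring G (χ G)) → Proper G c → ∀ a → ∃ λ v → a ≡ c v
  optimal-surjective c p a = decidable-stable (any? λ v → a ≟ c v) λ ∄v →
    let _ , j<χ , col = missed-color⇒fewer-colors c p a (λ v e → ∄v (v , e))
    in <⇒≱ j<χ (χ-minimal G col)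

  Meets : Coloring G k → Subset n → Fin k → Set
  Meets c S a = ∃ λ v → v ∈ S × c v ≡ a

  meets? : (c : Coloring G k) (S : Subset n) (a : Fin k) → Dec (Meets c S a)
  meets? c S a = any? λ v → (v ∈? S) ×-dec (c v ≟ a)

  determining⇒misses-≤1 : (c : Coloring G (χ G)) → Proper G c → {S : Subset n} →
    Determining G c S → ∀ {a b} → ¬ Meets c S a → ¬ Meets c S b → a ≡ b
  determining⇒misses-≤1 c p det {a} {b} a∉ b∉ with optimal-surjective c p a
  -- Swapping `a` and `b` changes no color on `S`, so the swapped coloring equals `c` everywhere. At
  -- `v`, which has color `a`, its value is `b`.
  ... | v , refl = trans (sym (det _ (proper-permute (transpose a b) c p) agree v)) (transpose-left a b)
    where
    agree : ∀ {u} → u ∈ _ → transpose a b ⟨$⟩ʳ c u ≡ c u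
    agree u∈S = transpose-fixes a b _ (λ e → a∉ (_ , u∈S , e)) (λ e → b∉ (_ , u∈S , e))

  -- Any color serves as the excluded one when no color is missed.
  determining⇒meets-all-but-one : (c : Coloring G (χ G)) → Proper G c → {S : Subset n} →
    Determining G c S → Fin (χ G) → ∃ λ a → ∀ b → b ≢ a → Meets c S b
  determining⇒meets-all-but-one c p {S} det a₀ with any? (¬? ∘ meets? c S)
  ... | yes (a , a∉) = a , λ b b≢a → decidable-stable (meets? c S b) λ b∉ →
                         b≢a (determining⇒misses-≤1 c p det b∉ a∉)
  ... | no  ∄missed  = a₀ , λ b _ → decidable-stable (meets? c S b) λ b∉ → ∄missed (b , b∉)

  -- Unique colorability compares colorings only with a fixed `c₀`; the permutation here goes from
  -- `c` back to `c₀` and then on to `c′`.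
  differ-by-permutation : UniquelyColorable G → (c c′ : Coloring G (χ G)) →
    Proper G c → Proper G c′ → ∃ λ (ρ : Permutation′ (χ G)) → c′ ≗ (ρ ⟨$⟩ʳ_) ∘ c
  differ-by-permutation (c₀ , _ , unique) c c′ p p′ with unique c p | unique c′ p′
  ... | π , c≗πc₀ | π′ , c′≗π′c₀ = flip π ∘ₚ π′ , λ v → begin
    c′ v                             ≡⟨ c′≗π′c₀ v ⟩
    π′ ⟨$⟩ʳ c₀ v                     ≡⟨ cong (π′ ⟨$⟩ʳ_) (inverseˡ π) ⟨
    π′ ⟨$⟩ʳ (π ⟨$⟩ˡ (π ⟨$⟩ʳ c₀ v))   ≡⟨ cong (λ x → π′ ⟨$⟩ʳ (π ⟨$⟩ˡ x)) (c≗πc₀ v) ⟨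
    π′ ⟨$⟩ʳ (π ⟨$⟩ˡ c v)             ∎
    where open ≡-Reasoning

  -- Let `c′` be `c` followed by `ρ`. Agreement at a vertex of `T` forces `ρ` to fix the color of
  -- that vertex, so `ρ` fixes every color except possibly `a`, and hence `a` too.
  meets-all-but-one⇒determining : UniquelyColorable G →
    (c : Coloring G (χ G)) → Proper G c → {T : Subset n} (a : Fin (χ G)) →
    (∀ b → b ≢ a → Meets c T b) → Determining G c T
  meets-all-but-one⇒determining uc c p a meets c′ p′ agree v
    with differ-by-permutation uc c c′ p p′
  ... | ρ , c′≗ρc = trans (c′≗ρc v) (fixes-all-but-one ρ a fix (c v))
    where
    fix : ∀ b → b ≢ a → ρ ⟨$⟩ʳ b ≡ b
    fix b b≢a with meets b b≢a
    ... | u , u∈T , refl = trans (sym (c′≗ρc u)) (agree u∈T)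

  ∣critical∣ : UniquelyColorable G → Fin (χ G) → CriticallyUniform G (χ G ∸ 1)
  ∣critical∣ uc a₀ S (c , p , det , minimal)
    with determining⇒meets-all-but-one c p det a₀
  ... | a , meets = trans (cong ∣_∣ (sym T≡S)) (∣image∣ f f-injective)
    where
    meet : ∀ j → Meets c S (skip a j)
    meet j = meets (skip a j) (skip-≢ a j)

    -- The transversal: `f j` is a vertex of `S` with color `skip a j`, so the colors alone tell its
    -- vertices apart.
    f : Fin (χ G ∸ 1) → Fin n
    f = proj₁ ∘ meet

    c∘f : ∀ j → c (f j) ≡ skip a j
    c∘f = proj₂ ∘ proj₂ ∘ meet

    f-injective : Injective _≡_ _≡_ f
    f-injective {i} {j} e = skip-injective a (trans (sym (c∘f i)) (trans (cong c e) (c∘f j)))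

    image⊆S : image f ⊆ S
    image⊆S v∈ with ∈-image⁻ f v∈
    ... | j , refl = proj₁ (proj₂ (meet j))

    image-meets : ∀ b → b ≢ a → Meets c (image f) b
    image-meets b b≢a with skip-surjective a b b≢a
    ... | j , refl = f j , ∈-image⁺ f j , c∘f j

    T≡S : image f ≡ S
    T≡S = minimal (image f) image⊆S (meets-all-but-one⇒determining uc c p a image-meets)

proposition1 : ∀ (n : ℕ) .{{_ : NonZero n}} (G : Graph n) →
    UniquelyColorable G → CriticallyUniform G (χ G ∸ 1)
-- The color of vertex `zero` shows that `χ G` is positive, so `∸` is genuine subtraction here.
proposition1 (suc n) G uc = ∣critical∣ G uc (proj₁ uc zero)
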